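{- For every positive integer $n$, the circular permutations in $\mathrm{Av}_n[1324]$ are in one-to-one correspondence with the circled compositions of $n$; in particular $\#\mathrm{Av}_n[1324]$ equals the number of circled compositions of $n$.
   Context: A circular permutation $[\pi]$ of size $n$ is the set of all rotations of a permutation $\pi$ of $[n]$; $[\sigma]$ contains $[\pi]$ if some rotation of $\sigma$ has a subsequence order-isomorphic to $\pi$, otherwise avoids it; $\mathrm{Av}_n[1324]$ is the set of circular permutations of size $n$ avoiding $[1324]$. A circled composition of $n$ is a pair $(a,C)$ where $a=(a_1,\dots,a_k)$ is a composition of $n$ into positive parts and $C\subseteq\{1,\dots,k\}$ satisfies $1\in C$, $k\in C$, and $a_i=1$ for every $i\in C$. -}

module Defs where

open import Data.Nat using (ℕ; zero; suc; _+_; _<_)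
open import Data.Nat.DivMod using (_mod_)
open import Data.Fin using (Fin; toℕ) renaming (_<_ to _<ᶠ_)
open import Data.Fin.Patterns using (0F; 1F; 2F; 3F)
open import Data.Nat.ListAction using (sum)
open import Data.List using (List; []; _∷_; length; head; last; zip)
open import Data.List.Relation.Unary.All using (All)
open import Data.Bool using (Bool; true)
open import Data.Maybe using (just)
open import Data.Product using (Σ; ∃; ∃-syntax; _×_; proj₁)
open import Relation.Nullary using (¬_)
open import Relation.Binary.PropositionalEquality using (_≡_)
open import Function.Definitions using (Injective)

-- A permutation of [n], represented by its one-line notation
-- i ↦ π(i) as an injective map Fin n → Fin n (values 0..n-1 encode 1..n).
IsPerm : (n : ℕ) → (Fin n → Fin n) → Set
IsPerm n p = Injective _≡_ _≡_ p

Perm : ℕ → Set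
Perm n = Σ (Fin n → Fin n) (IsPerm n)

rotate : {A : Set} (n : ℕ) → (Fin n → A) → ℕ → (Fin n → A)
rotate zero    w r ()
rotate (suc m) w r i = w ((toℕ i + r) mod (suc m))

Contains : {n k : ℕ} → (Fin n → Fin n) → (Fin k → Fin k) → Set
Contains {n} {k} w π =
  ∃ λ (e : Fin k → Fin n) → ((∀ (a b : Fin k) → a <ᶠ b → e a <ᶠ e b) ×
          (∀ (a b : Fin k) → ((π a <ᶠ π b → w (e a) <ᶠ w (e b)) ×
                              (w (e a) <ᶠ w (e b) → π a <ᶠ π b))))

CircContains : {n k : ℕ} → (Fin n → Fin n) → (Fin k → Fin k) → Set
CircContains {n} σ π = ∃[ r ] Contains (rotate n σ r) π

p1324 : Fin 4 → Fin 4
p1324 0F = 0F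
p1324 1F = 2F
p1324 2F = 1F
p1324 3F = 3F

-- Permutations of [n] whose circular class avoids [1324]
-- (circular containment is invariant under rotation of σ, so this is a
-- property of the class).
AvPerm1324 : ℕ → Set
AvPerm1324 n = Σ (Perm n) (λ σ → ¬ CircContains (proj₁ σ) p1324)

-- Two permutations represent the same circular permutation iff one is a
-- rotation of the other.  Av_n[1324] is AvPerm1324 n modulo this relation.
_∼ᶜ_ : {n : ℕ} → AvPerm1324 n → AvPerm1324 n → Set
_∼ᶜ_ {n} σ τ = ∃[ r ] (∀ i → proj₁ (proj₁ σ) i ≡ rotate n (proj₁ (proj₁ τ)) r i)

-- Circled composition of n: parts a = (a_1..a_k), and circ = the
-- characteristic list of C ⊆ {1..k} (circ_i = true iff i ∈ C).
record IsCircledComposition (n : ℕ) (parts : List ℕ) (circ : List Bool) : Set where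
  field
    sameLength : length circ ≡ length parts
    positive   : All (λ a → 0 < a) parts
    sums       : sum parts ≡ n
    firstIn    : head circ ≡ just true
    lastIn     : last circ ≡ just true
    circledOne : All (λ ac → Σ.proj₂ ac ≡ true → Σ.proj₁ ac ≡ 1) (zip parts circ)

CircledComposition : ℕ → Set
CircledComposition n =
  Σ (List ℕ × List Bool) (λ ac → IsCircledComposition n (Σ.proj₁ ac) (Σ.proj₂ ac))

_≈ᶜᶜ_ : {n : ℕ} → CircledComposition n → CircledComposition n → Set
x ≈ᶜᶜ y = proj₁ x ≡ proj₁ y

{-# OPTIONS --safe #-}
module Submission where

-- Rotate the circular permutation so that it starts with its least value. Avoiding [1324] then means
-- that the values met up to the maximum increase, while the values met after the maximum split into
-- intervals of consecutive values, each read increasingly, the intervals themselves in decreasing order.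
-- The values of the first kind become the circled parts 1 and the intervals become the uncircled parts,
-- all listed by increasing value. Coding each value by one letter turns this into a word, and the word
-- fixes the relative order of any two positions; conversely every word satisfying the end conditions
-- prescribes such an order, which is realized by ranking the values with an explicit sort key.

open import Defs
open import Data.Nat using (ℕ; zero; suc; _+_; _*_; _≤_; _<_; z≤n; s≤s; z<s; s<s; _≤?_; _<?_; _≟_; s≤s⁻¹)
open import Data.Nat.Properties using
  ( ≤-refl; ≤-trans; ≤-antisym; ≤-reflexive; <-irrefl; <-asym; <-trans; <⇒≤; <⇒≢; <⇒≱; ≮⇒≥; ≰⇒>; ≤∧≢⇒<
  ; <-≤-trans; ≤-<-trans; m≤m+n; m≤n+m; +-assoc; +-comm; +-suc; +-monoʳ-<; +-monoˡ-<; +-cancelʳ-<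
  ; *-monoˡ-≤; 1+n≰n; n≮0; n<1+n; m≤n⇒∃[o]m+o≡n; <-cmp; *-suc; +-mono-<; m<m+n; suc-injective)
open import Data.Nat.DivMod using (_%_; _mod_; m%n<n; m<n⇒m%n≡m; %-distribˡ-+; m%n%n≡m%n; [m+n]%n≡m%n; [m+kn]%n≡m%n)
open import Data.Fin using (Fin; zero; suc; toℕ; fromℕ; fromℕ<; inject₁; punchOut) renaming (_<_ to _<ᶠ_; _≤_ to _≤ᶠ_)
import Data.Fin as Fin
open import Data.Fin.Induction using (<-weakInduction)
open import Data.Fin.Patterns using (0F; 1F; 2F; 3F)
open import Data.Fin.Properties using
  ( toℕ-injective; toℕ<n; toℕ-fromℕ; toℕ-fromℕ<; toℕ-inject₁; inject₁-injective; ≤fromℕ; any?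
  ; punchOut-injective; injective⇒≤)
open import Data.Fin.Relation.Unary.Top using (view; ‵fromℕ; ‵inject₁)
open import Data.Fin.Subset using (∣_∣; _∈_)
open import Data.Fin.Subset.Properties using (p⊂q⇒∣p∣<∣q∣; ∣⊤∣≡n; ∈⊤)
open import Data.Vec using (Vec; []; _∷_; lookup; map; sum; tabulate)
open import Data.Vec.Properties using (lookup∘tabulate; tabulate∘lookup; tabulate-cong; []=⇒lookup; lookup⇒[]=)
open import Data.Bool using (Bool; true; false)
open import Data.List using (List; []; _∷_; length; head; last; zip)
open import Data.List.Relation.Unary.All using (All; []; _∷_)
open import Data.Maybe using (just)
open import Data.Maybe.Properties using (just-injective)
open import Data.Nat.ListAction using () renaming (sum to ∑)
open import Data.Product using (∃-syntax; _×_; _,_; proj₁; proj₂)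
open import Data.Sum using (_⊎_; inj₁; inj₂)
open import Function using (_∘_)
open import Function.Definitions using (Congruent; Injective; Surjective)
open import Relation.Binary.Definitions using (tri<; tri≈; tri>)
open import Relation.Nullary using (¬_; Dec; yes; no; does; contradiction)
open import Relation.Nullary.Decidable using (_×-dec_; _⊎-dec_; dec-true)
open import Relation.Binary.PropositionalEquality using (_≡_; _≢_; _≗_; refl; sym; trans; cong; subst; subst₂)

private variable
  k m n : ℕ

-- Injective and order-preserving maps of finite sets

abstract

  -- A missed value could be punched out, leaving an injection of `Fin (suc n)` into `Fin n`.
  injective⇒surjective : {f : Fin n → Fin n} → Injective _≡_ _≡_ f → ∀ y → ∃[ x ] f x ≡ y
  injective⇒surjective {suc n} {f} inj y with any? (λ x → f x Fin.≟ y)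
  ... | yes hit = hit
  ... | no miss = contradiction (injective⇒≤ punched-injective) 1+n≰n
    where
    avoided : ∀ x → y ≢ f x
    avoided x eq = miss (x , sym eq)
    punched-injective : Injective _≡_ _≡_ (λ x → punchOut (avoided x))
    punched-injective {x} {x′} = inj ∘ punchOut-injective (avoided x) (avoided x′)

module Inverse {f : Fin n → Fin n} (inj : Injective _≡_ _≡_ f) where

  inverse : Fin n → Fin n
  inverse y = proj₁ (injective⇒surjective inj y)

  inverseʳ : ∀ y → f (inverse y) ≡ y
  inverseʳ y = proj₂ (injective⇒surjective inj y)

  inverseˡ : ∀ x → inverse (f x) ≡ x
  inverseˡ x = inj (inverseʳ (f x))

  inverse-injective : Injective _≡_ _≡_ inverse
  inverse-injective {x} {y} eq = trans (sym (inverseʳ x)) (trans (cong f eq) (inverseʳ y))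

open Inverse

-- Induction on `i`: each strict step raises the value by at least one.
strictMono⇒inflationary : (g : Fin m → Fin n) → (∀ {i j} → i <ᶠ j → g i <ᶠ g j) → ∀ i → i ≤ᶠ g i
strictMono⇒inflationary g mono zero = z≤n
strictMono⇒inflationary g mono (suc i) = ≤-<-trans
  (strictMono⇒inflationary (g ∘ inject₁) inject₁-mono i)
  (mono (≤-reflexive (cong suc (toℕ-inject₁ i))))
  where
  inject₁-mono : ∀ {i j} → i <ᶠ j → g (inject₁ i) <ᶠ g (inject₁ j)
  inject₁-mono {i} {j} i<j = mono (subst₂ _<_ (sym (toℕ-inject₁ i)) (sym (toℕ-inject₁ j)) i<j)

-- The map `q` after the inverse of `p` is strictly increasing, hence inflationary; it is evaluated
-- at `p v`.
orderPreserving⇒≤ : {p q : Fin n → Fin n} → Injective _≡_ _≡_ p →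
  (∀ {v w} → p v <ᶠ p w → q v <ᶠ q w) → ∀ v → p v ≤ᶠ q v
orderPreserving⇒≤ {p = p} {q} inj pres v =
  subst (λ u → p v ≤ᶠ q u) (inverseˡ inj v)
    (strictMono⇒inflationary (q ∘ inverse inj)
      (λ {i} {j} i<j → pres (subst₂ _<ᶠ_ (sym (inverseʳ inj i)) (sym (inverseʳ inj j)) i<j)) (p v))

orderIsomorphic⇒≗ : {p q : Fin n → Fin n} → Injective _≡_ _≡_ p → Injective _≡_ _≡_ q →
  (∀ {v w} → p v <ᶠ p w → q v <ᶠ q w) → (∀ {v w} → q v <ᶠ q w → p v <ᶠ p w) → p ≗ q
orderIsomorphic⇒≗ p-inj q-inj to from v =
  toℕ-injective (≤-antisym (orderPreserving⇒≤ p-inj to v) (orderPreserving⇒≤ q-inj from v))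

does-true⁻ : {A : Set} (d : Dec A) → does d ≡ true → A
does-true⁻ (yes a) _ = a

-- Ranking by a key

module Rank (key : Fin n → ℕ) where

  below : Fin n → Vec Bool n
  below v = tabulate (λ u → does (key u <? key v))

  ∈-below⁺ : ∀ {u v} → key u < key v → u ∈ below v
  ∈-below⁺ {u} {v} u<v = lookup⇒[]= u _ (trans (lookup∘tabulate _ u) (dec-true (key u <? key v) u<v))

  ∈-below⁻ : ∀ {u v} → u ∈ below v → key u < key v
  ∈-below⁻ {u} {v} u∈ = does-true⁻ (key u <? key v)
    (trans (sym (lookup∘tabulate _ u)) ([]=⇒lookup u∈))

  -- As `v` is not below itself, `below v` is a proper subset of the full set.
  rank-bound : ∀ v → ∣ below v ∣ < n
  rank-bound v = subst (∣ below v ∣ <_) (∣⊤∣≡n n)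
    (p⊂q⇒∣p∣<∣q∣ ((λ _ → ∈⊤) , v , ∈⊤ , λ v∈ → <-irrefl refl (∈-below⁻ v∈)))

  rank : Fin n → Fin n
  rank v = fromℕ< (rank-bound v)

  rank-mono : ∀ {v w} → key v < key w → rank v <ᶠ rank w
  rank-mono {v} {w} v<w = subst₂ _<_ (sym (toℕ-fromℕ< (rank-bound v))) (sym (toℕ-fromℕ< (rank-bound w)))
    (p⊂q⇒∣p∣<∣q∣ ((λ u∈ → ∈-below⁺ (<-trans (∈-below⁻ u∈) v<w)) , v , ∈-below⁺ v<w , λ v∈ → <-irrefl refl (∈-below⁻ v∈)))

-- Upward induction on intervals; words and their blocks

interval-induction : (P : Fin (suc n) → Set) (v : Fin (suc n)) → P v →
  (∀ w → v ≤ᶠ inject₁ w → P (inject₁ w) → P (suc w)) → ∀ w → v ≤ᶠ w → P w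
interval-induction {n} P v base step = <-weakInduction (λ w → v ≤ᶠ w → P w) at-zero at-suc
  where
  at-zero : v ≤ᶠ zero {n} → P zero
  at-zero v≤0 = subst P (toℕ-injective (≤-antisym v≤0 z≤n)) base
  at-suc : ∀ w → (v ≤ᶠ inject₁ w → P (inject₁ w)) → v ≤ᶠ suc w → P (suc w)
  at-suc w ih v≤1+w with v Fin.≟ suc w
  ... | yes refl = base
  ... | no v≢1+w = step w v≤w (ih v≤w)
    where
    v≤w : v ≤ᶠ inject₁ w
    v≤w = subst (toℕ v ≤_) (sym (toℕ-inject₁ w)) (s≤s⁻¹ (≤∧≢⇒< v≤1+w (v≢1+w ∘ toℕ-injective)))

-- joined: in the same block as the next larger value; closing: the largest value of its block.
data Letter : Set where
  circled joined closing : Letter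

circled? : (x : Letter) → Dec (x ≡ circled)
circled? circled = yes refl
circled? joined  = no λ ()
circled? closing = no λ ()

weight : Letter → ℕ
weight joined = 0
weight _      = 1

-- Counts the letters other than `joined` from `v` on. The count is constant within a block and
-- drops after its last value, so it numbers the blocks in decreasing order of value; a `circled`
-- letter also makes it drop.
blocks : Vec Letter n → Fin n → ℕ
blocks w       zero    = sum (map weight w)
blocks (x ∷ w) (suc v) = blocks w v

blocks-step : (L : Vec Letter (suc n)) (v : Fin n) →
  blocks L (inject₁ v) ≡ weight (lookup L (inject₁ v)) + blocks L (suc v)
blocks-step (x ∷ y ∷ w) zero    = refl
blocks-step (x ∷ y ∷ w) (suc v) = blocks-step (y ∷ w) v

blocks-antimono : (L : Vec Letter (suc n)) {v w : Fin (suc n)} → v ≤ᶠ w → blocks L w ≤ blocks L v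
blocks-antimono L {v} {w} = interval-induction (λ u → blocks L u ≤ blocks L v) v ≤-refl
  (λ u _ ih → ≤-trans (≤-trans (m≤n+m _ _) (≤-reflexive (sym (blocks-step L u)))) ih) w

-- `first` and `final` mirror the two end conditions on `C`; `step` keeps a block from being cut
-- short by a circled value.
record Valid (L : Vec Letter (suc m)) : Set where
  field
    first : lookup L zero ≡ circled
    final : lookup L (fromℕ m) ≡ circled
    step  : ∀ v → lookup L (inject₁ v) ≡ joined → lookup L (suc v) ≢ circled

module _ (L : Vec Letter (suc m)) where

  blocks-squeeze : ∀ {v x w} → v ≤ᶠ x → x ≤ᶠ w → blocks L v ≡ blocks L w → blocks L v ≡ blocks L x
  blocks-squeeze v≤x x≤w eq =
    ≤-antisym (≤-trans (≤-reflexive eq) (blocks-antimono L x≤w)) (blocks-antimono L v≤x)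

  -- Any letter of weight one at `u` would make the count drop before `suc u`.
  same-block⇒joined : ∀ {v} u → v ≤ᶠ inject₁ u → blocks L v ≡ blocks L (suc u) →
    blocks L v ≡ blocks L (inject₁ u) × lookup L (inject₁ u) ≡ joined
  same-block⇒joined {v} u v≤u eq = same , weightless _ (trans (sym (blocks-step L u)) (trans (sym same) eq))
    where
    same : blocks L v ≡ blocks L (inject₁ u)
    same = blocks-squeeze v≤u (subst (_≤ suc (toℕ u)) (sym (toℕ-inject₁ u)) (<⇒≤ (n<1+n _))) eq
    weightless : ∀ x → weight x + blocks L (suc u) ≡ blocks L (suc u) → x ≡ joined
    weightless joined  _  = refl
    weightless circled eq = contradiction (≤-reflexive eq) 1+n≰n
    weightless closing eq = contradiction (≤-reflexive eq) 1+n≰n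

  -- Walking up from `v` inside the block, every letter left behind is `joined`, and `step` forbids
  -- a circled letter after it.
  same-block⇒uncircled : Valid L → ∀ {v w} → v ≤ᶠ w → lookup L v ≢ circled → blocks L v ≡ blocks L w →
    lookup L w ≢ circled
  same-block⇒uncircled valid {v} {w} v≤w v∉C = interval-induction
    (λ u → blocks L v ≡ blocks L u → lookup L u ≢ circled) v (λ _ → v∉C)
    (λ u v≤u _ eq → Valid.step valid u (proj₂ (same-block⇒joined u v≤u eq))) w v≤w


-- The order of positions prescribed by a word

-- Meant for `v` smaller than `w`: a circled value precedes every larger value, an uncircled one
-- only the larger values of its own block.
Ascent : Vec Letter n → Fin n → Fin n → Set
Ascent L v w = lookup L v ≡ circled ⊎ blocks L v ≡ blocks L w

ascent? : (L : Vec Letter n) (v w : Fin n) → Dec (Ascent L v w)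
ascent? L v w = circled? (lookup L v) ⊎-dec (blocks L v ≟ blocks L w)

-- p v is the position of the value v: the circled values come first, in increasing order, and the
-- blocks of the remaining values follow in decreasing order, each block being read increasingly.
record Realizes (L : Vec Letter n) (p : Fin n → ℕ) : Set where
  field
    ascent  : ∀ {v w} → v <ᶠ w → Ascent L v w → p v < p w
    descent : ∀ {v w} → v <ᶠ w → ¬ Ascent L v w → p w < p v

open Realizes

module _ {L : Vec Letter n} where

  realizes-mono : {p q : Fin n → ℕ} → (∀ {v w} → p v < p w → q v < q w) → Realizes L p → Realizes L q
  realizes-mono mono r .ascent v<w  = mono ∘ ascent r v<w
  realizes-mono mono r .descent v<w = mono ∘ descent r v<w

  realizes-cong : {p q : Fin n → ℕ} → p ≗ q → Realizes L p → Realizes L q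
  realizes-cong p≗q = realizes-mono (subst₂ _<_ (p≗q _) (p≗q _))

  module _ {p : Fin n → ℕ} (r : Realizes L p) where

    ascent⁻ : ∀ {v w} → v <ᶠ w → p v < p w → Ascent L v w
    ascent⁻ {v} {w} v<w pv<pw with ascent? L v w
    ... | yes a = a
    ... | no ¬a = contradiction pv<pw (<-asym (descent r v<w ¬a))

    descent⁻ : ∀ {v w} → v <ᶠ w → p w < p v → ¬ Ascent L v w
    descent⁻ v<w pw<pv a = <-asym pw<pv (ascent r v<w a)

    realizes⇒distinct : ∀ {v w} → v <ᶠ w → p v ≢ p w
    realizes⇒distinct {v} {w} v<w with ascent? L v w
    ... | yes a = <⇒≢ (ascent r v<w a)
    ... | no ¬a = <⇒≢ (descent r v<w ¬a) ∘ sym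

    realizes⇒injective : ∀ {v w} → p v ≡ p w → v ≡ w
    realizes⇒injective {v} {w} eq with <-cmp (toℕ v) (toℕ w)
    ... | tri< v<w _ _ = contradiction eq (realizes⇒distinct v<w)
    ... | tri≈ _ v≡w _ = toℕ-injective v≡w
    ... | tri> _ _ w<v = contradiction (sym eq) (realizes⇒distinct w<v)

    -- The word decides every pair of values, so any two realizations compare them alike.
    realizes⇒order : ∀ {q} → Realizes L q → ∀ {v w} → p v < p w → q v < q w
    realizes⇒order rq {v} {w} pv<pw with <-cmp (toℕ v) (toℕ w)
    ... | tri< v<w _ _ = ascent rq v<w (ascent⁻ v<w pv<pw)
    ... | tri≈ _ v≡w _ = contradiction (cong p (toℕ-injective v≡w)) (<⇒≢ pv<pw)
    ... | tri> _ _ w<v = descent rq w<v (descent⁻ w<v pv<pw)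

realizes-unique : {L : Vec Letter n} {p q : Fin n → Fin n} → Realizes L (toℕ ∘ p) → Realizes L (toℕ ∘ q) → p ≗ q
realizes-unique rp rq = orderIsomorphic⇒≗ (realizes⇒injective rp ∘ cong toℕ) (realizes⇒injective rq ∘ cong toℕ)
  (realizes⇒order rp rq) (realizes⇒order rq rp)

module _ {L : Vec Letter (suc m)} {p : Fin (suc m) → ℕ} (r : Realizes L p) where

  -- If `v` precedes `w`, then `v` is circled or the whole interval from `v` to `w` is one block;
  -- either way `v` precedes `x`.
  avoids-213 : ∀ {v x w} → v <ᶠ x → x <ᶠ w → p x < p v → ¬ p v < p w
  avoids-213 v<x x<w px<pv pv<pw with ascent⁻ r (<-trans v<x x<w) pv<pw
  ... | inj₁ c  = descent⁻ r v<x px<pv (inj₁ c)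
  ... | inj₂ eq = descent⁻ r v<x px<pv (inj₂ (blocks-squeeze L (<⇒≤ v<x) (<⇒≤ x<w) eq))

  -- Since `d` precedes `a`, the value `a` is uncircled, so `a` and `c` share a block. It contains
  -- `b` too, and a block is read increasingly.
  avoids-4132 : Valid L → ∀ {a b c d} → a <ᶠ b → b <ᶠ c → c <ᶠ d → p d < p a → p a < p c → ¬ p c < p b
  avoids-4132 valid {a} {b} {c} a<b b<c c<d pd<pa pa<pc pc<pb = go (ascent⁻ r a<c pa<pc)
    where
    a<c = <-trans a<b b<c
    a∉C = descent⁻ r (<-trans a<c c<d) pd<pa ∘ inj₁
    go : ¬ Ascent L a c
    go (inj₁ a∈C) = a∉C a∈C
    go (inj₂ eq)  = descent⁻ r b<c pc<pb
      (inj₂ (trans (sym (blocks-squeeze L (<⇒≤ a<b) (<⇒≤ b<c) eq)) eq))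

-- A sort key realizing every valid word

module _ (L : Vec Letter n) where

  -- Circled values keep keys below `n`. The offset `n` puts the others after them, and the base-`n`
  -- digits sort these by block number and then by value.
  circled-key : ∀ {x} → Dec (x ≡ circled) → Fin n → ℕ
  circled-key (yes _) v = toℕ v
  circled-key (no _)  v = n + (blocks L v * n + toℕ v)

  key : Fin n → ℕ
  key v = circled-key (circled? (lookup L v)) v

  circled-key-low : ∀ {x} (d : Dec (x ≡ circled)) v → toℕ v ≤ circled-key d v
  circled-key-low (yes _) v = ≤-refl
  circled-key-low (no _)  v = ≤-trans (m≤n+m (toℕ v) _) (m≤n+m _ n)

key-realizes : (L : Vec Letter (suc m)) → Valid L → Realizes L (key L)
key-realizes {m} L valid = record { ascent = asc ; descent = desc }
  where
  asc : ∀ {v w} → v <ᶠ w → Ascent L v w → key L v < key L w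
  asc {v} {w} v<w a with circled? (lookup L v) | circled? (lookup L w)
  ... | yes _  | d      = <-≤-trans v<w (circled-key-low L d w)
  asc v<w (inj₁ v∈C) | no v∉C | _ = contradiction v∈C v∉C
  asc v<w (inj₂ eq) | no v∉C | yes w∈C = contradiction w∈C (same-block⇒uncircled L valid (<⇒≤ v<w) v∉C eq)
  asc {v} {w} v<w (inj₂ eq) | no v∉C | no _ =
    +-monoʳ-< (suc m) (subst (λ b → blocks L v * suc m + toℕ v < b * suc m + toℕ w) eq (+-monoʳ-< (blocks L v * suc m) v<w))
  desc : ∀ {v w} → v <ᶠ w → ¬ Ascent L v w → key L w < key L v
  desc {v} {w} v<w ¬a with circled? (lookup L v) | circled? (lookup L w)
  ... | yes v∈C | _     = contradiction (inj₁ v∈C) ¬a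
  ... | no _    | yes _ = <-≤-trans (toℕ<n w) (m≤m+n (suc m) _)
  -- The block number of `w` is strictly smaller, and the low digit `toℕ w` is below `suc m`, so it
  -- cannot make up for the difference.
  ... | no _    | no _  = +-monoʳ-< (suc m) (<-≤-trans (+-monoʳ-< (blocks L w * suc m) (toℕ<n w))
    (≤-trans (≤-reflexive (+-comm (blocks L w * suc m) (suc m)))
      (≤-trans (*-monoˡ-≤ (suc m) (≤∧≢⇒< (blocks-antimono L (<⇒≤ v<w)) (¬a ∘ inj₂ ∘ sym))) (m≤m+n _ (toℕ v)))))

-- Reading a word off the positions

module _ (p : Fin (suc m) → ℕ) where

  -- Asking for a preimage under `inject₁` leaves the maximum, which has no successor, unjoined.
  Joined : Fin (suc m) → Set
  Joined v = ∃[ u ] inject₁ u ≡ v × p (inject₁ u) < p (suc u)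

  joined? : ∀ v → Dec (Joined v)
  joined? v = any? λ u → (inject₁ u Fin.≟ v) ×-dec (p (inject₁ u) <? p (suc u))

  -- The position `p (fromℕ m)` of the largest value is the cut between the circled values and the
  -- blocks.
  letter : Fin (suc m) → Letter
  letter v with p v ≤? p (fromℕ m) | joined? v
  ... | yes _ | _     = circled
  ... | no _  | yes _ = joined
  ... | no _  | no _  = closing

  word : Vec Letter (suc m)
  word = tabulate letter

  letter-circled⁺ : ∀ {v} → p v ≤ p (fromℕ m) → letter v ≡ circled
  letter-circled⁺ {v} le with p v ≤? p (fromℕ m) | joined? v
  ... | yes _ | _ = refl
  ... | no gt | _ = contradiction le gt

  letter-circled⁻ : ∀ {v} → letter v ≡ circled → p v ≤ p (fromℕ m)
  letter-circled⁻ {v} eq with p v ≤? p (fromℕ m) | joined? v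
  letter-circled⁻ _  | yes le | _     = le
  letter-circled⁻ () | no _   | yes _
  letter-circled⁻ () | no _   | no _

  letter-joined⁺ : ∀ {u} → p (fromℕ m) < p (inject₁ u) → p (inject₁ u) < p (suc u) → letter (inject₁ u) ≡ joined
  letter-joined⁺ {u} gt lt with p (inject₁ u) ≤? p (fromℕ m) | joined? (inject₁ u)
  ... | yes le | _     = contradiction le (<⇒≱ gt)
  ... | no _   | yes _ = refl
  ... | no _   | no ¬j = contradiction (u , refl , lt) ¬j

  letter-joined⁻ : ∀ {u} → letter (inject₁ u) ≡ joined →
    p (fromℕ m) < p (inject₁ u) × p (inject₁ u) < p (suc u)
  letter-joined⁻ {u} eq with p (inject₁ u) ≤? p (fromℕ m) | joined? (inject₁ u)
  letter-joined⁻ () | yes _ | _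
  letter-joined⁻ _  | no gt | yes (u′ , u′≡u , lt) with inject₁-injective u′≡u
  ... | refl = ≰⇒> gt , lt
  letter-joined⁻ () | no _  | no _

  letter-closing⁺ : ∀ {v} → p (fromℕ m) < p v → (∀ u → inject₁ u ≡ v → p (suc u) ≤ p v) → letter v ≡ closing
  letter-closing⁺ {v} gt desc with p v ≤? p (fromℕ m) | joined? v
  ... | yes le | _ = contradiction le (<⇒≱ gt)
  ... | no _ | yes (u , refl , lt) = contradiction (desc u refl) (<⇒≱ lt)
  ... | no _ | no _ = refl

  uncircled⇒after-max : ∀ {v} → letter v ≢ circled → p (fromℕ m) < p v
  uncircled⇒after-max ne = ≰⇒> (ne ∘ letter-circled⁺)

≢fromℕ⇒< : {v : Fin (suc m)} → v ≢ fromℕ m → v <ᶠ fromℕ m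
≢fromℕ⇒< v≢ = ≤∧≢⇒< (≤fromℕ _) (v≢ ∘ toℕ-injective)

inject₁<suc : (u : Fin m) → inject₁ u <ᶠ suc u
inject₁<suc u = ≤-reflexive (cong suc (toℕ-inject₁ u))

-- Recovering a valid word from a realization

module _ {L : Vec Letter (suc m)} (valid : Valid L) {p : Fin (suc m) → ℕ} (r : Realizes L p) where

  open Valid valid

  -- Otherwise `v` would share a block with the maximum, which is circled, although no circled value
  -- follows an uncircled one within a block.
  uncircled-after-max : ∀ {v} → lookup L v ≢ circled → p (fromℕ m) < p v
  uncircled-after-max {v} v∉C = descent r (≢fromℕ⇒< v≢max) no-ascent
    where
    v≢max : v ≢ fromℕ m
    v≢max refl = v∉C final
    no-ascent : ¬ Ascent L v (fromℕ m)
    no-ascent (inj₁ v∈C) = v∉C v∈C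
    no-ascent (inj₂ eq)  = same-block⇒uncircled L valid (≤fromℕ v) v∉C eq final

  -- Comparing `v` with the maximum detects circled letters; comparing it with its successor tells
  -- `joined` from `closing`.
  letter-realized : ∀ v → letter p v ≡ lookup L v
  letter-realized v with lookup L v in eq | view v
  ... | circled | _ = letter-circled⁺ p before-max
    where
    before-max : p v ≤ p (fromℕ m)
    before-max with v Fin.≟ fromℕ m
    ... | yes refl = ≤-refl
    ... | no v≢max = <⇒≤ (ascent r (≢fromℕ⇒< v≢max) (inj₁ eq))
  ... | joined | ‵fromℕ = contradiction (trans (sym eq) final) λ ()
  ... | joined | ‵inject₁ u = letter-joined⁺ p (uncircled-after-max λ c → contradiction (trans (sym eq) c) λ ())
    (ascent r (inject₁<suc u) (inj₂ (trans (blocks-step L u) (cong (λ x → weight x + blocks L (suc u)) eq))))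
  ... | closing | _ = letter-closing⁺ p (uncircled-after-max λ c → contradiction (trans (sym eq) c) λ ()) desc
    where
    desc : ∀ u → inject₁ u ≡ v → p (suc u) ≤ p v
    desc u refl = <⇒≤ (descent r (inject₁<suc u) no-ascent)
      where
      no-ascent : ¬ Ascent L (inject₁ u) (suc u)
      no-ascent (inj₁ c) = contradiction (trans (sym eq) c) λ ()
      no-ascent (inj₂ s) = contradiction (trans (sym eq) (proj₂ (same-block⇒joined L u ≤-refl s))) λ ()

  word-realized : word p ≡ L
  word-realized = trans (tabulate-cong letter-realized) (tabulate∘lookup L)

-- From avoidance to a realized word

-- For a permutation starting with its least value, avoiding [1324] amounts to these two conditions.
record Avoiding (p : Fin (suc m) → ℕ) : Set where
  field
    injective  : ∀ {v w} → p v ≡ p w → v ≡ w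
    zero-first : p zero ≡ 0
    no-1324    : ∀ {a b c d} → a <ᶠ b → b <ᶠ c → c <ᶠ d → p a < p c → p c < p b → ¬ p b < p d
    no-4132    : ∀ {a b c d} → a <ᶠ b → b <ᶠ c → c <ᶠ d → p d < p a → p a < p c → ¬ p c < p b

module _ {p : Fin (suc m) → ℕ} (avoiding : Avoiding p) where

  open Avoiding avoiding

  private
    w : Vec Letter (suc m)
    w = word p

    max : Fin (suc m)
    max = fromℕ m

  word-lookup : ∀ v → lookup w v ≡ letter p v
  word-lookup = lookup∘tabulate (letter p)

  compare : ∀ {v w} → v ≢ w → ¬ p v < p w → p w < p v
  compare v≢w v≮w = ≤∧≢⇒< (≮⇒≥ v≮w) (v≢w ∘ sym ∘ injective)

  nonzero : ∀ {v w} → p w < p v → zero {m} <ᶠ v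
  nonzero {zero}  {w} w<v = contradiction (subst (p w <_) zero-first w<v) λ ()
  nonzero {suc v} _ = z<s

  positive-position : ∀ {v} (w : Fin (suc m)) → w <ᶠ v → p zero < p v
  positive-position {suc v} _ _ = compare {suc v} (λ ()) λ lt → n≮0 (subst (p (suc v) <_) zero-first lt)

  -- If `x` came before `v`, the values `zero`, `x`, `v`, `y` would be read as 1324; if `y` came
  -- before `x`, then `max`, `v`, `y`, `x` would be read as 4132.
  convex : ∀ {v x y} → v <ᶠ x → x <ᶠ y → p max < p v → p v < p y → p v < p x × p x < p y
  convex {v} {x} {y} v<x x<y max<v v<y =
      compare {x} {v} (λ { refl → <-irrefl refl v<x }) (λ x<v → no-1324 (nonzero max<v) v<x x<y (positive-position v v<x) x<v v<y)
    , compare {y} {x} (λ { refl → <-irrefl refl x<y })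
        (λ y<x → no-4132 v<x x<y (≢fromℕ⇒< λ { refl → <-asym max<v v<y }) max<v v<y y<x)

  word-valid : Valid w
  word-valid = record
    { first = trans (word-lookup zero) (letter-circled⁺ p (subst (_≤ p max) (sym zero-first) z≤n))
    ; final = trans (word-lookup max) (letter-circled⁺ p ≤-refl)
    ; step  = λ v v∈J v∈C → let max<v , v<v+1 = letter-joined⁻ p (trans (sym (word-lookup (inject₁ v))) v∈J)
                                   in <⇒≱ (<-trans max<v v<v+1) (letter-circled⁻ p (trans (sym (word-lookup (suc v))) v∈C))
    }

  word-realizes : Realizes w p
  word-realizes = record { ascent = asc ; descent = desc }
    where
    asc : ∀ {v x} → v <ᶠ x → Ascent w v x → p v < p x
    -- With `x` before `v`, the values `zero`, `x`, `v`, `max` would be read as 1324.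
    asc {v} {x} v<x (inj₁ v∈C) = compare {x} {v} (λ { refl → <-irrefl refl v<x }) λ x<v →
      no-1324 (nonzero x<v) v<x (≢fromℕ⇒< λ { refl → <⇒≱ x<v v≤max })
        (positive-position v v<x) x<v
        (compare {max} {v} (λ { refl → <⇒≱ v<x (≤fromℕ x) }) (λ max<v → <⇒≱ max<v v≤max))
      where
      v≤max : p v ≤ p max
      v≤max = letter-circled⁻ p (trans (sym (word-lookup v)) v∈C)
    -- Every letter from `v` up to just before `x` is `joined`, so positions rise along the way;
    -- injectivity makes the rise strict.
    asc {v} {x} v<x (inj₂ same) = ≤∧≢⇒< (increasing x (<⇒≤ v<x) same) (λ eq → <⇒≢ v<x (cong toℕ (injective eq)))
      where
      increasing : ∀ x → v ≤ᶠ x → blocks w v ≡ blocks w x → p v ≤ p x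
      increasing = interval-induction _ v (λ _ → ≤-refl) λ u v≤u ih same →
        let same′ , u∈J = same-block⇒joined w u v≤u same
        in ≤-trans (ih same′) (<⇒≤ (proj₂ (letter-joined⁻ p (trans (sym (word-lookup (inject₁ u))) u∈J))))
    desc : ∀ {v x} → v <ᶠ x → ¬ Ascent w v x → p x < p v
    -- By contraposition: if the uncircled `v` precedes `x`, then `convex` makes positions rise
    -- along the whole interval, which is therefore one block.
    desc {v} {x} v<x ¬asc = compare {v} {x} (λ { refl → <-irrefl refl v<x })
      λ v<x′ → ¬asc (inj₂ (one-block v<x′ x (<⇒≤ v<x) ≤-refl))
      where
      max<v : p max < p v
      max<v = uncircled⇒after-max p (¬asc ∘ inj₁ ∘ trans (word-lookup v))
      one-block : p v < p x → ∀ y → v ≤ᶠ y → y ≤ᶠ x → blocks w v ≡ blocks w y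
      one-block pv<px = interval-induction _ v (λ _ → refl) step
        where
        step : ∀ u → v ≤ᶠ inject₁ u → (inject₁ u ≤ᶠ x → blocks w v ≡ blocks w (inject₁ u)) →
          suc u ≤ᶠ x → blocks w v ≡ blocks w (suc u)
        step u v≤u ih u+1≤x = trans (ih (≤-trans (<⇒≤ (inject₁<suc u)) u+1≤x)) (trans (blocks-step w u)
          (cong (λ l → weight l + blocks w (suc u)) (trans (word-lookup (inject₁ u)) u∈J)))
          where
          v<u+1 : v <ᶠ suc u
          v<u+1 = ≤-<-trans v≤u (inject₁<suc u)
          below-end : ∀ y → v <ᶠ y → y ≤ᶠ x → p v < p y
          below-end y v<y y≤x with y Fin.≟ x
          ... | yes refl = pv<px
          ... | no y≢x = proj₁ (convex v<y (≤∧≢⇒< y≤x (y≢x ∘ toℕ-injective)) max<v pv<px)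
          pv<pu+1 : p v < p (suc u)
          pv<pu+1 = below-end (suc u) v<u+1 u+1≤x
          u∈J : letter p (inject₁ u) ≡ joined
          u∈J with v Fin.≟ inject₁ u
          ... | yes refl = letter-joined⁺ p max<v pv<pu+1
          -- `convex` is used again, now with `suc u` as the right end, to compare `u` with its
          -- successor.
          ... | no v≢u = let v<u , u<u+1 = convex (≤∧≢⇒< v≤u (v≢u ∘ toℕ-injective)) (inject₁<suc u) max<v pv<pu+1
                         in letter-joined⁺ p (<-trans max<v v<u) u<u+1

-- Words and circled compositions

-- A circled part is spelled by one circled letter, an uncircled part suc k by k joined letters and a closing one.
data Spells : Vec Letter n → List ℕ → List Bool → Set where
  []       : Spells [] [] []
  circled∷ : ∀ {w : Vec Letter n} {as bs} → Spells w as bs → Spells (circled ∷ w) (1 ∷ as) (true ∷ bs)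
  closing∷ : ∀ {w : Vec Letter n} {as bs} → Spells w as bs → Spells (closing ∷ w) (1 ∷ as) (false ∷ bs)
  joined∷  : ∀ {w : Vec Letter n} {a as bs} → Spells w (suc a ∷ as) (false ∷ bs) →
             Spells (joined ∷ w) (suc (suc a) ∷ as) (false ∷ bs)

spells-functional : {w : Vec Letter n} {as as′ : List ℕ} {bs bs′ : List Bool} →
  Spells w as bs → Spells w as′ bs′ → (as , bs) ≡ (as′ , bs′)
spells-functional []           []           = refl
spells-functional (circled∷ s) (circled∷ t) with refl ← spells-functional s t = refl
spells-functional (closing∷ s) (closing∷ t) with refl ← spells-functional s t = refl
spells-functional (joined∷ s)  (joined∷ t)  with refl ← spells-functional s t = refl

spells-injective : {w w′ : Vec Letter n} {as : List ℕ} {bs : List Bool} → Spells w as bs → Spells w′ as bs → w ≡ w′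
spells-injective []           []           = refl
spells-injective (circled∷ s) (circled∷ t) = cong (circled ∷_) (spells-injective s t)
spells-injective (closing∷ s) (closing∷ t) = cong (closing ∷_) (spells-injective s t)
spells-injective (joined∷ s)  (joined∷ t)  = cong (joined ∷_) (spells-injective s t)

open IsCircledComposition

isCircled : Letter → Bool
isCircled circled = true
isCircled _       = false

isCircled⁻ : ∀ {x} → isCircled x ≡ true → x ≡ circled
isCircled⁻ {circled} _ = refl

spells-head : {w : Vec Letter (suc m)} {as : List ℕ} {bs : List Bool} → Spells w as bs →
  head bs ≡ just (isCircled (lookup w zero))
spells-head (circled∷ _) = refl
spells-head (closing∷ _) = refl
spells-head (joined∷ _)  = refl

spells-last : {w : Vec Letter (suc m)} {as : List ℕ} {bs : List Bool} → Spells w as bs →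
  last bs ≡ just (isCircled (lookup w (fromℕ m)))
spells-last {m = zero} (circled∷ [])  = refl
spells-last {m = zero} (closing∷ [])  = refl
-- Matching on `s` exposes the second entry, which `last` needs in order to reduce.
spells-last {m = suc _} (circled∷ s@(circled∷ _)) = spells-last s
spells-last {m = suc _} (circled∷ s@(closing∷ _)) = spells-last s
spells-last {m = suc _} (circled∷ s@(joined∷ _))  = spells-last s
spells-last {m = suc _} (closing∷ s@(circled∷ _)) = spells-last s
spells-last {m = suc _} (closing∷ s@(closing∷ _)) = spells-last s
spells-last {m = suc _} (closing∷ s@(joined∷ _))  = spells-last s
spells-last {m = suc _} (joined∷ s) = spells-last s

spells-length : {w : Vec Letter n} {as : List ℕ} {bs : List Bool} → Spells w as bs → length bs ≡ length as
spells-length []           = refl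
spells-length (circled∷ s) = cong suc (spells-length s)
spells-length (closing∷ s) = cong suc (spells-length s)
spells-length (joined∷ s)  = spells-length s

spells-sum : {w : Vec Letter n} {as : List ℕ} {bs : List Bool} → Spells w as bs → ∑ as ≡ n
spells-sum []           = refl
spells-sum (circled∷ s) = cong suc (spells-sum s)
spells-sum (closing∷ s) = cong suc (spells-sum s)
spells-sum (joined∷ s)  = cong suc (spells-sum s)

spells-positive : {w : Vec Letter n} {as : List ℕ} {bs : List Bool} → Spells w as bs → All (λ a → 0 < a) as
spells-positive []           = []
spells-positive (circled∷ s) = z<s ∷ spells-positive s
spells-positive (closing∷ s) = z<s ∷ spells-positive s
spells-positive (joined∷ s) with _ ∷ ps ← spells-positive s = z<s ∷ ps

CircledOne : ℕ × Bool → Set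
CircledOne ac = proj₂ ac ≡ true → proj₁ ac ≡ 1

spells-circledOne : {w : Vec Letter n} {as : List ℕ} {bs : List Bool} → Spells w as bs → All CircledOne (zip as bs)
spells-circledOne []           = []
spells-circledOne (circled∷ s) = (λ _ → refl) ∷ spells-circledOne s
spells-circledOne (closing∷ s) = (λ ()) ∷ spells-circledOne s
spells-circledOne (joined∷ s) with _ ∷ ps ← spells-circledOne s = (λ ()) ∷ ps

spells⇒circledComposition : {w : Vec Letter (suc m)} {as : List ℕ} {bs : List Bool} →
  Valid w → Spells w as bs → IsCircledComposition (suc m) as bs
spells⇒circledComposition valid s = record
  { sameLength = spells-length s
  ; positive   = spells-positive s
  ; sums       = spells-sum s
  ; firstIn    = trans (spells-head s) (cong (just ∘ isCircled) (Valid.first valid))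
  ; lastIn     = trans (spells-last s) (cong (just ∘ isCircled) (Valid.final valid))
  ; circledOne = spells-circledOne s
  }

-- The field `step` of `Valid` on its own: unlike `first`, it passes to tails, as recursion on the
-- word requires.
Joinable : Vec Letter (suc m) → Set
Joinable {m} w = ∀ (v : Fin m) → lookup w (inject₁ v) ≡ joined → lookup w (suc v) ≢ circled

-- Built from the right end: a joined letter enlarges the part after it, which `Joinable` guarantees
-- to be uncircled.
valid⇒spelling : (w : Vec Letter (suc m)) → lookup w (fromℕ m) ≡ circled → Joinable w →
  ∃[ as ] ∃[ bs ] Spells w as bs
valid⇒spelling (x ∷ []) refl _ = _ , _ , circled∷ []
valid⇒spelling (x ∷ w@(y ∷ _)) final joinable = prepend x (joinable zero) (valid⇒spelling w final (joinable ∘ suc))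
  where
  prepend : ∀ x → (x ≡ joined → y ≢ circled) → (∃[ as ] ∃[ bs ] Spells w as bs) → ∃[ as ] ∃[ bs ] Spells (x ∷ w) as bs
  prepend circled _  (_ , _ , s)          = _ , _ , circled∷ s
  prepend closing _  (_ , _ , s)          = _ , _ , closing∷ s
  prepend joined  ok (_ , _ , circled∷ _) = contradiction refl (ok refl)
  prepend joined  _  (_ , _ , closing∷ s) = _ , _ , joined∷ (closing∷ s)
  prepend joined  _  (_ , _ , joined∷ s)  = _ , _ , joined∷ (joined∷ s)

spells-joinable : {w : Vec Letter (suc m)} {as : List ℕ} {bs : List Bool} → Spells w as bs → Joinable w
spells-joinable (joined∷ (closing∷ _)) zero _ ()
spells-joinable (joined∷ (joined∷ _))  zero _ ()
spells-joinable {m = suc _} (circled∷ s) (suc v) = spells-joinable s v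
spells-joinable {m = suc _} (closing∷ s) (suc v) = spells-joinable s v
spells-joinable {m = suc _} (joined∷ s)  (suc v) = spells-joinable s v

spells-block : ∀ a {w : Vec Letter n} {as bs} → Spells w as bs →
  ∃[ w′ ] Spells {suc a + n} w′ (suc a ∷ as) (false ∷ bs)
spells-block zero    s = _ , closing∷ s
spells-block (suc a) s = _ , joined∷ (proj₂ (spells-block a s))

spelling : ∀ as bs → length bs ≡ length as → All (λ a → 0 < a) as → All CircledOne (zip as bs) →
  ∃[ w ] Spells {∑ as} w as bs
spelling []           []           _   _        _        = [] , []
spelling (suc a ∷ as) (false ∷ bs) len (_ ∷ ps) (_ ∷ cs) =
  spells-block a (proj₂ (spelling as bs (suc-injective len) ps cs))
spelling (a ∷ as)     (true ∷ bs)  len (_ ∷ ps) (c ∷ cs) with refl ← c refl =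
  _ , circled∷ (proj₂ (spelling as bs (suc-injective len) ps cs))

circledComposition⇒spelling : ∀ {as bs} → IsCircledComposition (suc m) as bs →
  ∃[ w ] Valid {m} w × Spells w as bs
circledComposition⇒spelling {m} {as} {bs} cc
  -- The spelled word has length `∑ as` by construction and is transported to length `suc m`.
  with w , s ← subst (λ n → ∃[ w ] Spells {n} w as bs) (sums cc) (spelling as bs (sameLength cc) (positive cc) (circledOne cc))
  = w , valid , s
  where
  valid : Valid w
  valid = record
    { first = isCircled⁻ (just-injective (trans (sym (spells-head s)) (firstIn cc)))
    ; final = isCircled⁻ (just-injective (trans (sym (spells-last s)) (lastIn cc)))
    ; step  = spells-joinable s
    }

-- Rotations and cyclic order

module Rotation (m : ℕ) where

  n′ : ℕ
  n′ = suc m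

  shift : ℕ → Fin n′ → Fin n′
  shift r i = (toℕ i + r) mod n′

  toℕ-shift : ∀ r i → toℕ (shift r i) ≡ (toℕ i + r) % n′
  toℕ-shift r i = toℕ-fromℕ< (m%n<n (toℕ i + r) n′)

  +-%-absorbˡ : ∀ a b → (a % n′ + b) % n′ ≡ (a + b) % n′
  +-%-absorbˡ a b = trans (%-distribˡ-+ (a % n′) b n′)
    (trans (cong (λ c → (c + b % n′) % n′) (m%n%n≡m%n a n′)) (sym (%-distribˡ-+ a b n′)))

  shift-shift : ∀ a b i → shift a (shift b i) ≡ shift (b + a) i
  shift-shift a b i = toℕ-injective (trans (toℕ-shift a (shift b i)) (trans
    (cong (λ x → (x + a) % n′) (toℕ-shift b i)) (trans (+-%-absorbˡ (toℕ i + b) a)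
      (trans (cong (_% n′) (+-assoc (toℕ i) b a)) (sym (toℕ-shift (b + a) i))))))

  shift-multiple : ∀ a i → shift (a * n′) i ≡ i
  shift-multiple a i = toℕ-injective (trans (toℕ-shift (a * n′) i)
    (trans ([m+kn]%n≡m%n (toℕ i) a n′) (m<n⇒m%n≡m (toℕ<n i))))

  -- Since `r + r * m` is `r * suc m`, a multiple of the size, this inverts a shift by `r` without
  -- subtraction.
  undo : ℕ → ℕ
  undo r = r * m

  shift-undo : ∀ r i → shift (undo r) (shift r i) ≡ i
  shift-undo r i = trans (shift-shift (undo r) r i)
    (trans (cong (λ x → shift x i) (sym (*-suc r m))) (shift-multiple r i))

  undo-shift : ∀ r i → shift r (shift (undo r) i) ≡ i
  undo-shift r i = trans (shift-shift r (undo r) i) (trans (cong (λ x → shift x i) (+-comm (undo r) r))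
    (trans (sym (shift-shift (undo r) r i)) (shift-undo r i)))

  shift-injective : ∀ r {i j} → shift r i ≡ shift r j → i ≡ j
  shift-injective r {i} {j} eq = trans (sym (shift-undo r i)) (trans (cong (shift (undo r)) eq) (shift-undo r j))

  shift-via-zero : ∀ r i → shift r i ≡ shift (toℕ i) (shift r zero)
  shift-via-zero r i = trans (cong (_mod n′) (+-comm (toℕ i) r)) (sym (shift-shift (toℕ i) r zero))

  shift-toℕ-zero : ∀ i → shift (toℕ i) zero ≡ i
  shift-toℕ-zero i = toℕ-injective (trans (toℕ-shift (toℕ i) zero) (m<n⇒m%n≡m (toℕ<n i)))

  -- The point `shift r i` lies `toℕ i` places beyond `shift r zero`, so the image of `zero` fixes
  -- the rotation.
  shift-determined : ∀ r s → shift r zero ≡ shift s zero → ∀ i → shift r i ≡ shift s i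
  shift-determined r s eq i = trans (shift-via-zero r i) (trans (cong (shift (toℕ i)) eq) (sym (shift-via-zero s i)))

  -- One constructor for each place where the circle can be cut.
  data Cyclic (a b c d : Fin n′) : Set where
    abcd : a <ᶠ b → b <ᶠ c → c <ᶠ d → Cyclic a b c d
    bcda : b <ᶠ c → c <ᶠ d → d <ᶠ a → Cyclic a b c d
    cdab : c <ᶠ d → d <ᶠ a → a <ᶠ b → Cyclic a b c d
    dabc : d <ᶠ a → a <ᶠ b → b <ᶠ c → Cyclic a b c d

  module _ {r : ℕ} (r<n : r < n′) where

    shift-inside : ∀ i → toℕ i + r < n′ → toℕ (shift r i) ≡ toℕ i + r
    shift-inside i lt = trans (toℕ-shift r i) (m<n⇒m%n≡m lt)

    shift-wrapped : ∀ i → n′ ≤ toℕ i + r → toℕ (shift r i) + n′ ≡ toℕ i + r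
    shift-wrapped i ge with o , eq ← m≤n⇒∃[o]m+o≡n ge = trans (cong (_+ n′)
        (trans (toℕ-shift r i) (trans (cong (_% n′) eq′) (trans ([m+n]%n≡m%n o n′) (m<n⇒m%n≡m o<n)))))
        (sym eq′)
      where
      eq′ : toℕ i + r ≡ o + n′
      eq′ = trans (sym eq) (+-comm n′ o)
      o<n : o < n′
      o<n = +-cancelʳ-< n′ o n′ (subst (_< n′ + n′) eq′ (+-mono-< (toℕ<n i) r<n))

    shift-mono-inside : ∀ {i j} → i <ᶠ j → toℕ j + r < n′ → shift r i <ᶠ shift r j
    shift-mono-inside {i} {j} i<j lt = subst₂ _<_ (sym (shift-inside i (<-trans i+r<j+r lt))) (sym (shift-inside j lt)) i+r<j+r
      where
      i+r<j+r = +-monoˡ-< r i<j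

    shift-mono-wrapped : ∀ {i j} → i <ᶠ j → n′ ≤ toℕ i + r → shift r i <ᶠ shift r j
    shift-mono-wrapped {i} {j} i<j ge = +-cancelʳ-< n′ _ _
      (subst₂ _<_ (sym (shift-wrapped i ge)) (sym (shift-wrapped j (≤-trans ge (<⇒≤ i+r<j+r)))) i+r<j+r)
      where
      i+r<j+r = +-monoˡ-< r i<j

    -- A wrapped point lands below `r`, an unwrapped one at `r` or above.
    shift-wraps-below : ∀ {i j} → toℕ i + r < n′ → n′ ≤ toℕ j + r → shift r j <ᶠ shift r i
    shift-wraps-below {i} {j} lt ge = <-≤-trans
      (+-cancelʳ-< n′ _ r (subst₂ _<_ (sym (shift-wrapped j ge)) (+-comm n′ r) (+-monoˡ-< r (toℕ<n j))))
      (subst (r ≤_) (sym (shift-inside i lt)) (m≤n+m r (toℕ i)))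

    -- If a point wraps, so do all larger ones. The wrapped points move in front and order is kept
    -- within both groups, so only the cut changes.
    reduced-shift-cyclic : ∀ {a b c d} → a <ᶠ b → b <ᶠ c → c <ᶠ d →
      Cyclic (shift r a) (shift r b) (shift r c) (shift r d)
    reduced-shift-cyclic {a} {b} {c} {d} a<b b<c c<d
      with n′ ≤? toℕ a + r | n′ ≤? toℕ b + r | n′ ≤? toℕ c + r | n′ ≤? toℕ d + r
    ... | yes a+ | _ | _ | _ = abcd (wrapped a<b a+) (wrapped b<c b+) (wrapped c<d (≤-trans b+ (<⇒≤ (+-monoˡ-< r b<c))))
      where
      wrapped = shift-mono-wrapped
      b+ = ≤-trans a+ (<⇒≤ (+-monoˡ-< r a<b))
    ... | no a- | yes b+ | _ | _ = bcda (shift-mono-wrapped b<c b+) (shift-mono-wrapped c<d c+)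
        (shift-wraps-below (≰⇒> a-) (≤-trans c+ (<⇒≤ (+-monoˡ-< r c<d))))
      where
      c+ = ≤-trans b+ (<⇒≤ (+-monoˡ-< r b<c))
    ... | no a- | no b- | yes c+ | _ = cdab (shift-mono-wrapped c<d c+)
        (shift-wraps-below (≰⇒> a-) (≤-trans c+ (<⇒≤ (+-monoˡ-< r c<d)))) (shift-mono-inside a<b (≰⇒> b-))
    ... | no a- | no b- | no c- | yes d+ = dabc (shift-wraps-below (≰⇒> a-) d+)
        (shift-mono-inside a<b (≰⇒> b-)) (shift-mono-inside b<c (≰⇒> c-))
    ... | no a- | no b- | no c- | no d- =
        abcd (shift-mono-inside a<b (≰⇒> b-)) (shift-mono-inside b<c (≰⇒> c-)) (shift-mono-inside c<d (≰⇒> d-))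

  shift-reduce : ∀ r i → shift (r % n′) i ≡ shift r i
  shift-reduce r = shift-determined (r % n′) r (toℕ-injective
    (trans (toℕ-shift (r % n′) zero) (trans (m%n%n≡m%n r n′) (sym (toℕ-shift r zero)))))

  shift-cyclic : ∀ r {a b c d} → a <ᶠ b → b <ᶠ c → c <ᶠ d →
    Cyclic (shift r a) (shift r b) (shift r c) (shift r d)
  shift-cyclic r {a} {b} {c} {d} a<b b<c c<d
    rewrite sym (shift-reduce r a) | sym (shift-reduce r b) | sym (shift-reduce r c) | sym (shift-reduce r d)
    = reduced-shift-cyclic (m%n<n r n′) a<b b<c c<d

-- Occurrences of 1324

Increasing : (Fin 4 → Fin n) → Set
Increasing f = f 0F <ᶠ f 1F × f 1F <ᶠ f 2F × f 2F <ᶠ f 3F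

increasing⇒mono : {f : Fin 4 → Fin n} → Increasing f → ∀ a b → a <ᶠ b → f a <ᶠ f b
increasing⇒mono (x , y , z) 0F 1F _ = x
increasing⇒mono (x , y , z) 0F 2F _ = <-trans x y
increasing⇒mono (x , y , z) 0F 3F _ = <-trans x (<-trans y z)
increasing⇒mono (x , y , z) 1F 2F _ = y
increasing⇒mono (x , y , z) 1F 3F _ = <-trans y z
increasing⇒mono (x , y , z) 2F 3F _ = z
increasing⇒mono _ 1F 1F (s≤s ())
increasing⇒mono _ 2F 1F (s≤s ())
increasing⇒mono _ 2F 2F (s≤s (s≤s ()))
increasing⇒mono _ 3F 1F (s≤s ())
increasing⇒mono _ 3F 2F (s≤s (s≤s ()))
increasing⇒mono _ 3F 3F (s≤s (s≤s (s≤s ())))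

p1324-involutive : ∀ a → p1324 (p1324 a) ≡ a
p1324-involutive 0F = refl
p1324-involutive 1F = refl
p1324-involutive 2F = refl
p1324-involutive 3F = refl

-- As `p1324` is an involution, `w ∘ e ∘ p1324` lists the chosen values by rank, so two increasing
-- chains settle all comparisons.
contains-1324 : {w : Fin n → Fin n} {e : Fin 4 → Fin n} → Increasing e → Increasing (w ∘ e ∘ p1324) → Contains w p1324
contains-1324 {w = w} {e} e-inc w-inc = e , increasing⇒mono {f = e} e-inc , λ a b → to a b , from a b
  where
  to : ∀ a b → p1324 a <ᶠ p1324 b → w (e a) <ᶠ w (e b)
  to a b lt = subst₂ (λ x y → w (e x) <ᶠ w (e y)) (p1324-involutive a) (p1324-involutive b)
    (increasing⇒mono {f = w ∘ e ∘ p1324} w-inc (p1324 a) (p1324 b) lt)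
  from : ∀ a b → w (e a) <ᶠ w (e b) → p1324 a <ᶠ p1324 b
  from a b lt with <-cmp (toℕ (p1324 a)) (toℕ (p1324 b))
  ... | tri< below _ _ = below
  ... | tri≈ _ eq _ = contradiction (cong (toℕ ∘ w ∘ e)
    (trans (sym (p1324-involutive a)) (trans (cong p1324 (toℕ-injective eq)) (p1324-involutive b)))) (<⇒≢ lt)
  ... | tri> _ _ above = contradiction lt (<-asym (to b a above))

contains-cong : {w w′ : Fin n → Fin n} {π : Fin k → Fin k} → w ≗ w′ → Contains w π → Contains w′ π
contains-cong w≗w′ (e , mono , iso) = e , mono , λ a b →
  subst₂ _<ᶠ_ (w≗w′ (e a)) (w≗w′ (e b)) ∘ proj₁ (iso a b) ,
  proj₂ (iso a b) ∘ subst₂ _<ᶠ_ (sym (w≗w′ (e a))) (sym (w≗w′ (e b)))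

-- Circular containment in terms of positions

module _ {m : ℕ} where

  open Rotation m

  quadruple : Fin n′ → Fin n′ → Fin n′ → Fin n′ → Fin 4 → Fin n′
  quadruple a b c d 0F = a
  quadruple a b c d 1F = b
  quadruple a b c d 2F = c
  quadruple a b c d 3F = d

  circContains-rotate : ∀ r {w : Fin n′ → Fin n′} {π : Fin k → Fin k} → CircContains (rotate n′ w r) π → CircContains w π
  circContains-rotate r {w} (s , c) = s + r , contains-cong (λ i → cong w (shift-shift r s i)) c

  module _ (σ p : Fin n′ → Fin n′) (σ∘p : ∀ v → σ (p v) ≡ v) where

    linear-1324 : ∀ {a b c d} → a <ᶠ b → b <ᶠ c → c <ᶠ d →
      p a <ᶠ p c → p c <ᶠ p b → p b <ᶠ p d → CircContains σ p1324
    linear-1324 {a} {b} {c} {d} a<b b<c c<d pa<pc pc<pb pb<pd = 0 , contains-1324 {w = rotate n′ σ 0} {e = quadruple (p a) (p c) (p b) (p d)}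
      (pa<pc , pc<pb , pb<pd)
      (subst₂ _<ᶠ_ (value a) (value b) a<b , subst₂ _<ᶠ_ (value b) (value c) b<c , subst₂ _<ᶠ_ (value c) (value d) c<d)
      where
      value : ∀ v → v ≡ σ (shift 0 (p v))
      value v = trans (sym (σ∘p v)) (cong σ (sym (shift-multiple 0 (p v))))

    -- The occurrence appears in the rotation starting just after position p d.
    wrapped-1324 : ∀ {a b c d} → a <ᶠ b → b <ᶠ c → c <ᶠ d →
      p d <ᶠ p a → p a <ᶠ p c → p c <ᶠ p b → CircContains σ p1324
    wrapped-1324 {a} {b} {c} {d} a<b b<c c<d pd<pa pa<pc pc<pb =
      r , contains-1324 {w = rotate n′ σ r} {e = quadruple (back pd<pa) (back pd<pc) (back pd<pb) (fromℕ m)}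
      (back-mono pd<pa pd<pc pa<pc , back-mono pd<pc pd<pb pc<pb , back<last)
      ( subst₂ _<ᶠ_ (value pd<pa) (value pd<pb) a<b
      , subst₂ _<ᶠ_ (value pd<pb) (value pd<pc) b<c
      , subst₂ _<ᶠ_ (value pd<pc) last-value c<d)
      where
      pd<pc = <-trans pd<pa pa<pc
      pd<pb = <-trans pd<pc pc<pb
      r : ℕ
      r = suc (toℕ (p d))
      offset : ∀ {x} → p d <ᶠ p x → ∃[ i ] toℕ {n′} i + r ≡ toℕ (p x)
      offset {x} lt with o , eq ← m≤n⇒∃[o]m+o≡n lt = fromℕ< o<n , trans (cong (_+ r) (toℕ-fromℕ< o<n)) (trans (+-comm o r) eq)
        where
        o<n : o < n′
        o<n = ≤-<-trans (≤-trans (m≤n+m o r) (≤-reflexive eq)) (toℕ<n (p x))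
      back : ∀ {x} → p d <ᶠ p x → Fin n′
      back = proj₁ ∘ offset
      back-toℕ : ∀ {x} (lt : p d <ᶠ p x) → toℕ (back lt) + r ≡ toℕ (p x)
      back-toℕ = proj₂ ∘ offset
      back-mono : ∀ {x y} (l : p d <ᶠ p x) (l′ : p d <ᶠ p y) → p x <ᶠ p y → back l <ᶠ back l′
      back-mono l l′ lt = +-cancelʳ-< r _ _ (subst₂ _<_ (sym (back-toℕ l)) (sym (back-toℕ l′)) lt)
      back<last : back pd<pb <ᶠ fromℕ m
      back<last = <-≤-trans (subst (toℕ (back pd<pb) <_) (back-toℕ pd<pb) (m<m+n (toℕ (back pd<pb)) z<s)) (≤fromℕ (p b))
      value : ∀ {x} (lt : p d <ᶠ p x) → x ≡ σ (shift r (back lt))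
      value {x} lt = trans (sym (σ∘p x)) (cong σ (sym (toℕ-injective (trans (toℕ-shift r (back lt))
        (trans (cong (_% n′) (back-toℕ lt)) (m<n⇒m%n≡m (toℕ<n (p x))))))))
      last-value : d ≡ σ (shift r (fromℕ m))
      last-value = trans (sym (σ∘p d)) (cong σ (sym (toℕ-injective (trans (toℕ-shift r (fromℕ m))
        (trans (cong (_% n′) wrap) (trans ([m+n]%n≡m%n (toℕ (p d)) n′) (m<n⇒m%n≡m (toℕ<n (p d)))))))))
        where
        wrap : toℕ (fromℕ m) + r ≡ toℕ (p d) + n′
        wrap = trans (cong (_+ r) (toℕ-fromℕ m)) (trans (+-suc m _) (+-comm n′ (toℕ (p d))))

  -- An occurrence with values `a`, `b`, `c`, `d` in increasing order is read as `a`, `c`, `b`, `d`,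
  -- and rotating keeps the cyclic order of their positions.
  no-cyclic⇒avoids : {σ p : Fin n′ → Fin n′} → (∀ i → p (σ i) ≡ i) →
    (∀ {a b c d} → a <ᶠ b → b <ᶠ c → c <ᶠ d → ¬ Cyclic (p a) (p c) (p b) (p d)) → ¬ CircContains σ p1324
  no-cyclic⇒avoids {σ} {p} p∘σ none (r , e , mono , iso) =
    none (proj₁ (iso 0F 2F) z<s) (proj₁ (iso 2F 1F) (s<s z<s)) (proj₁ (iso 1F 3F) (s<s (s<s z<s))) cyclic
    where
    q : Fin 4 → Fin n′
    q x = shift r (e x)
    cyclic : Cyclic (p (σ (q 0F))) (p (σ (q 1F))) (p (σ (q 2F))) (p (σ (q 3F)))
    cyclic rewrite p∘σ (q 0F) | p∘σ (q 1F) | p∘σ (q 2F) | p∘σ (q 3F) =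
      shift-cyclic r (mono 0F 1F z<s) (mono 1F 2F (s<s z<s)) (mono 2F 3F (s<s (s<s z<s)))

  -- Cutting the cycle 1324 gives 1324, 3241, 2413 or 4132. The first three contain 213 and the last
  -- is excluded directly.
  realizes⇒no-cyclic : {L : Vec Letter n′} {p : Fin n′ → Fin n′} → Valid L → Realizes L (toℕ ∘ p) →
    ∀ {a b c d} → a <ᶠ b → b <ᶠ c → c <ᶠ d → ¬ Cyclic (p a) (p c) (p b) (p d)
  realizes⇒no-cyclic valid r a<b b<c c<d (abcd _ c<b b<d)   = avoids-213 r b<c c<d c<b b<d
  realizes⇒no-cyclic valid r a<b b<c c<d (bcda c<b b<d _)   = avoids-213 r b<c c<d c<b b<d
  realizes⇒no-cyclic valid r a<b b<c c<d (cdab b<d d<a a<c) = avoids-213 r a<b b<c (<-trans b<d d<a) a<c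
  realizes⇒no-cyclic valid r a<b b<c c<d (dabc d<a a<c c<b) = avoids-4132 r valid a<b b<c c<d d<a a<c c<b

  -- Normal forms starting with the least value

  perm : AvPerm1324 n′ → Fin n′ → Fin n′
  perm ((w , _) , _) = w

  perm-injective : ∀ σ → Injective _≡_ _≡_ (perm σ)
  perm-injective ((_ , inj) , _) = inj

  position : AvPerm1324 n′ → Fin n′ → Fin n′
  position σ = inverse {f = perm σ} (perm-injective σ)

  position-inverseʳ : ∀ σ v → perm σ (position σ v) ≡ v
  position-inverseʳ σ = inverseʳ {f = perm σ} (perm-injective σ)

  position-inverseˡ : ∀ σ i → position σ (perm σ i) ≡ i
  position-inverseˡ σ = inverseˡ {f = perm σ} (perm-injective σ)

  position-injective : ∀ σ → Injective _≡_ _≡_ (position σ)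
  position-injective σ = inverse-injective {f = perm σ} (perm-injective σ)

  position-cong : ∀ σ τ → perm σ ≗ perm τ → position σ ≗ position τ
  position-cong σ τ σ≗τ v = trans (sym (position-inverseˡ τ (position σ v)))
    (cong (position τ) (trans (sym (σ≗τ (position σ v))) (position-inverseʳ σ v)))

  position-cong⁻ : ∀ σ τ → position σ ≗ position τ → perm σ ≗ perm τ
  position-cong⁻ σ τ p≗q i = trans (sym (position-inverseʳ τ (perm σ i)))
    (cong (perm τ) (trans (sym (p≗q (perm σ i))) (position-inverseˡ σ i)))

  zero-position : AvPerm1324 n′ → ℕ
  zero-position σ = toℕ (position σ zero)

  normalise : AvPerm1324 n′ → AvPerm1324 n′
  normalise σ@(_ , avoids) =
    (rotate n′ (perm σ) z , λ eq → shift-injective z (perm-injective σ eq)) , avoids ∘ circContains-rotate z {perm σ}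
    where
    z : ℕ
    z = zero-position σ

  normalise-zero : ∀ σ → perm (normalise σ) zero ≡ zero
  normalise-zero σ = trans (cong (perm σ) (shift-toℕ-zero (position σ zero))) (position-inverseʳ σ zero)

  rotations-agree : {w : Fin n′ → Fin n′} → IsPerm n′ w → ∀ r s → rotate n′ w r zero ≡ rotate n′ w s zero →
    rotate n′ w r ≗ rotate n′ w s
  rotations-agree {w} inj r s eq i = cong w (shift-determined r s (inj eq) i)

  -- Both normal forms are rotations of `τ` with `zero` in front, and the entry in front determines
  -- a rotation.
  normalise-cong : ∀ {σ τ} → σ ∼ᶜ τ → perm (normalise σ) ≗ perm (normalise τ)
  normalise-cong {σ} {τ} (r , σ≗τr) i = trans (as-rotation i)
    (rotations-agree (perm-injective τ) (a + r) (zero-position τ) (trans (sym (as-rotation zero)) (trans (normalise-zero σ) (sym (normalise-zero τ)))) i)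
    where
    a : ℕ
    a = zero-position σ
    as-rotation : perm (normalise σ) ≗ rotate n′ (perm τ) (a + r)
    as-rotation j = trans (σ≗τr (shift a j)) (cong (perm τ) (shift-shift r a j))

  -- Undo the rotation of `σ`, pass to the equal normal form of `τ`, then apply the rotation of `τ`.
  normalise-reflects : ∀ {σ τ} → perm (normalise σ) ≗ perm (normalise τ) → σ ∼ᶜ τ
  normalise-reflects {σ} {τ} eq = undo a + b , λ i →
    trans (cong (perm σ) (sym (undo-shift a i))) (trans (eq (shift (undo a) i)) (cong (perm τ) (shift-shift b (undo a) i)))
    where
    a b : ℕ
    a = zero-position σ
    b = zero-position τ

  normalise-fixes : ∀ σ → perm σ zero ≡ zero → perm (normalise σ) ≗ perm σ
  normalise-fixes σ σ0≡0 i = trans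
    (rotations-agree (perm-injective σ) (zero-position σ) 0 (trans (normalise-zero σ) (sym σ0≡0)) i) (cong (perm σ) (shift-multiple 0 i))

  avoids⇒avoiding : ∀ σ → perm σ zero ≡ zero → Avoiding (toℕ ∘ position σ)
  avoids⇒avoiding σ@(_ , av) σ0≡0 = record
    { injective  = λ eq → position-injective σ (toℕ-injective eq)
    ; zero-first = cong toℕ (trans (cong (position σ) (sym σ0≡0)) (position-inverseˡ σ zero))
    ; no-1324    = λ a<b b<c c<d x y z → av (linear-1324 (perm σ) (position σ) (position-inverseʳ σ) a<b b<c c<d x y z)
    ; no-4132    = λ a<b b<c c<d x y z → av (wrapped-1324 (perm σ) (position σ) (position-inverseʳ σ) a<b b<c c<d x y z)
    }

  -- The correspondence with circled compositions

  wordOf : AvPerm1324 n′ → Vec Letter n′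
  wordOf σ = word (toℕ ∘ position (normalise σ))

  module _ (σ : AvPerm1324 n′) where

    wordOf-valid : Valid (wordOf σ)
    wordOf-valid = word-valid (avoids⇒avoiding (normalise σ) (normalise-zero σ))

    wordOf-realizes : Realizes (wordOf σ) (toℕ ∘ position (normalise σ))
    wordOf-realizes = word-realizes (avoids⇒avoiding (normalise σ) (normalise-zero σ))

    wordOf-spelling : ∃[ as ] ∃[ bs ] Spells (wordOf σ) as bs
    wordOf-spelling = valid⇒spelling (wordOf σ) (Valid.final wordOf-valid) (Valid.step wordOf-valid)

    composition : CircledComposition n′
    composition = let as , bs , s = wordOf-spelling in (as , bs) , spells⇒circledComposition wordOf-valid s

    composition-spells : Spells (wordOf σ) (proj₁ (proj₁ composition)) (proj₂ (proj₁ composition))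
    composition-spells = proj₂ (proj₂ wordOf-spelling)

  wordOf-unique : ∀ σ τ {L} → Valid L → Realizes L (toℕ ∘ position τ) →
    perm (normalise σ) ≗ perm τ → wordOf σ ≡ L
  wordOf-unique σ τ valid r eq = word-realized valid
    (realizes-cong (λ v → cong toℕ (sym (position-cong (normalise σ) τ eq v))) r)

  composition-determined : ∀ σ {L as bs} → wordOf σ ≡ L → Spells L as bs → proj₁ (composition σ) ≡ (as , bs)
  composition-determined σ refl = spells-functional (composition-spells σ)

  composition-cong : Congruent (_∼ᶜ_ {n′}) (_≈ᶜᶜ_ {n′}) composition
  composition-cong {σ} {τ} σ∼τ = composition-determined σ
    (wordOf-unique σ (normalise τ) (wordOf-valid τ) (wordOf-realizes τ) (normalise-cong {σ} {τ} σ∼τ))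
    (composition-spells τ)

  -- The composition fixes the word, the word fixes the positions in the normal form, and equal
  -- normal forms mean equal classes.
  composition-injective : Injective (_∼ᶜ_ {n′}) (_≈ᶜᶜ_ {n′}) composition
  composition-injective {σ} {τ} eq = normalise-reflects {σ} {τ} (position-cong⁻ (normalise σ) (normalise τ)
    (realizes-unique (wordOf-realizes σ)
      (subst (λ w → Realizes w (toℕ ∘ position (normalise τ))) (sym same-word) (wordOf-realizes τ))))
    where
    same-word : wordOf σ ≡ wordOf τ
    same-word = spells-injective (composition-spells σ)
      (subst (λ y → Spells (wordOf τ) (proj₁ y) (proj₂ y)) (sym eq) (composition-spells τ))

  -- The ranks of the sort key serve as positions, so the permutation is the inverse of `rank`.
  realize : (L : Vec Letter n′) → Valid L → ∃[ σ ] Realizes L (toℕ ∘ position σ)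
  realize L valid = ((inverse rank-injective , inverse-injective rank-injective) , avoids) ,
    realizes-cong (cong toℕ ∘ rank≗position) rank-realizes
    where
    open Rank (key L)
    rank-realizes : Realizes L (toℕ ∘ rank)
    rank-realizes = realizes-mono rank-mono (key-realizes L valid)
    rank-injective : Injective _≡_ _≡_ rank
    rank-injective eq = realizes⇒injective rank-realizes (cong toℕ eq)
    avoids : ¬ CircContains (inverse rank-injective) p1324
    avoids = no-cyclic⇒avoids (inverseʳ rank-injective) (realizes⇒no-cyclic valid rank-realizes)
    rank≗position : rank ≗ inverse (inverse-injective rank-injective)
    rank≗position v = inverse-injective rank-injective
      (trans (inverseˡ rank-injective v) (sym (inverseʳ (inverse-injective rank-injective) v)))

  realized-zero : ∀ σ {L} → Valid L → Realizes L (toℕ ∘ position σ) → perm σ zero ≡ zero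
  realized-zero σ valid r = go (perm σ zero) refl
    where
    go : ∀ v → perm σ zero ≡ v → perm σ zero ≡ zero
    go zero    eq = eq
    -- The circled `zero` precedes every larger value, so no larger value can occupy the first
    -- place.
    go (suc v) eq = contradiction (ascent r z<s (inj₁ (Valid.first valid)))
      (subst (λ i → ¬ toℕ (position σ zero) < toℕ i) (trans (sym (position-inverseˡ σ zero)) (cong (position σ) eq)) n≮0)

  composition-surjective : Surjective (_∼ᶜ_ {n′}) (_≈ᶜᶜ_ {n′}) composition
  composition-surjective (_ , cc) =
    let L , valid , spells = circledComposition⇒spelling cc
        σ , r = realize L valid
    -- Surjectivity asks for the equation on the whole class of `σ`, so `τ` is first replaced by
    -- `σ`, which already starts with `zero`.
    in σ , λ {τ} τ∼σ → trans (composition-cong {τ} {σ} τ∼σ) (composition-determined σ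
         (wordOf-unique σ σ valid r (normalise-fixes σ (realized-zero σ valid r))) spells)

theorem4p8 : (n : ℕ) → 1 ≤ n →
    ∃[ f ] (Congruent (_∼ᶜ_ {n}) (_≈ᶜᶜ_ {n}) f ×
    Injective (_∼ᶜ_ {n}) (_≈ᶜᶜ_ {n}) f ×
    Surjective (_∼ᶜ_ {n}) (_≈ᶜᶜ_ {n}) f)
theorem4p8 (suc m) _ = composition , (λ {σ} {τ} → composition-cong {m} {σ} {τ}) ,
  (λ {σ} {τ} → composition-injective {m} {σ} {τ}) , composition-surjective
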